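{- Let $n\ge 3$ and let $k\in[1..n-2]$ be coprime to $n$. Then there are exactly three strings $\mathsf{T}$ of length $n$ over $\{\mathtt{a},\mathtt{b}\}$ ($\mathtt{a}<\mathtt{b}$) whose suffix array $\mathsf{SA}_{\mathsf{T}}=[p_1,\ldots,p_n]$ is an arithmetically progressed permutation with ratio $k$. Each such $\mathsf{T}$ has the form $\mathsf{T}[i]=\mathtt{a}$ if $i\in\{p_1,\ldots,p_s\}$ and $\mathsf{T}[i]=\mathtt{b}$ otherwise, for some $s\in[1..n-1]$ (so $p_s$ is the start of the lexicographically largest suffix beginning with $\mathtt{a}$), and the three strings are determined by: (1) $p_1=n$ and $p_s=n-k-1$; (2) $p_1=k+1$ and $p_s=n-k$; (3) $p_1=1$ and $p_s=n-k$. The strings in cases (1) and (2) have period $n-k$, and the string in case (3) is a Lyndon word.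
   Context: Lexicographic order with a proper prefix smaller than the longer string; suffix array $\mathsf{SA}_{\mathsf{T}}$: permutation of $[1..n]$ such that $\mathsf{T}[\mathsf{SA}_{\mathsf{T}}[i]..n]$ is the $i$-th smallest suffix. $x\bmod n$ denotes the representative of $x$ modulo $n$ in $[1..n]$. An arithmetically progressed permutation of length $n$ with ratio $k\in[1..n-1]$ is a permutation $P=[p_1,\ldots,p_n]$ of $[1..n]$ with $p_{i+1}=p_i+k\bmod n$. A string $\mathsf{T}$ of length $n$ has period $p\in[1..n-1]$ if $\mathsf{T}[i]=\mathsf{T}[i+p]$ for all $i\in[1..n-p]$. A Lyndon word is a string that is strictly smaller in lexicographic order than all its other cyclic rotations. -}

module Defs where

open import Data.Nat using (ℕ; zero; suc; _+_; _∸_; _≤_; _<_; NonZero; _%_)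
open import Data.Fin as Fin using (Fin; toℕ)
open import Data.Fin.Properties using (nonZeroIndex)
open import Data.Fin.Permutation using (Permutation′; _⟨$⟩ʳ_)
open import Data.List using (List; drop; take; _++_)
open import Data.List.Relation.Binary.Lex.Strict using (Lex-<)
open import Data.Product using (Σ; ∃; _×_)
open import Data.Vec using (Vec; lookup; toList)
open import Relation.Binary.PropositionalEquality using (_≡_; _≢_)
open import Relation.Nullary using (¬_)

data Letter : Set where
  a b : Letter

data _<ᴸ_ : Letter → Letter → Set where
  a<b : a <ᴸ b

Word : ℕ → Set
Word n = Vec Letter n

-- In this order a proper prefix is smaller than the longer string.
infix 4 _≺_
_≺_ : List Letter → List Letter → Set
_≺_ = Lex-< _≡_ _<ᴸ_

-- Positions and indices in [1..n] are represented by elements of Fin n;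
-- i : Fin n stands for the 1-based number pos i.
pos : {n : ℕ} → Fin n → ℕ
pos i = suc (toℕ i)

-- T[pos i .. n]
suffix : {n : ℕ} → Word n → Fin n → List Letter
suffix T i = drop (toℕ i) (toList T)

-- The representative of x modulo n in [1..n] (rather than in [0..n-1]).
infixl 6 _mod_
_mod_ : (x n : ℕ) → .{{_ : NonZero n}} → ℕ
x mod n with x % n
... | zero  = n
... | suc r = suc r

-- P [ j ]≡ x  says that p_j = x, with j and x both 1-based.
infix 4 _[_]≡_
_[_]≡_ : {n : ℕ} → Permutation′ n → ℕ → ℕ → Set
_[_]≡_ {n} P j x = Σ (Fin n) λ i → pos i ≡ j × pos (P ⟨$⟩ʳ i) ≡ x

IsSuffixArray : {n : ℕ} → Word n → Permutation′ n → Set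
IsSuffixArray {n} T P =
  (i j : Fin n) → i Fin.< j → suffix T (P ⟨$⟩ʳ i) ≺ suffix T (P ⟨$⟩ʳ j)

record ArithProgressed {n : ℕ} (k : ℕ) (P : Permutation′ n) : Set where
  field
    1≤k  : 1 ≤ k
    k≤n-1 : k ≤ n ∸ 1
    step : (i j : Fin n) → pos j ≡ suc (pos i) →
           pos (P ⟨$⟩ʳ j) ≡ _mod_ (pos (P ⟨$⟩ʳ i) + k) n {{nonZeroIndex i}}

-- i ∈ {p_1, …, p_s}
AmongFirst : {n : ℕ} → Permutation′ n → ℕ → Fin n → Set
AmongFirst {n} P s i = Σ (Fin n) λ j → pos j ≤ s × P ⟨$⟩ʳ j ≡ i

record HasForm {n : ℕ} (T : Word n) (P : Permutation′ n) (s : ℕ) : Set where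
  field
    1≤s    : 1 ≤ s
    s≤n-1  : s ≤ n ∸ 1
    inside  : (i : Fin n) → AmongFirst P s i → lookup T i ≡ a
    outside : (i : Fin n) → ¬ AmongFirst P s i → lookup T i ≡ b

StartsLargestASuffix : {n : ℕ} → Word n → Fin n → Set
StartsLargestASuffix {n} T i =
  lookup T i ≡ a ×
  ((j : Fin n) → lookup T j ≡ a → j ≢ i → suffix T j ≺ suffix T i)

HasAPSuffixArray : {n : ℕ} → ℕ → Word n → Set
HasAPSuffixArray k T = ∃ λ P → IsSuffixArray T P × ArithProgressed k P

-- T is the string whose suffix array P has ratio k, p_1 = x and p_s = y, s being
-- the number of a's; and k, x, y leave no other choice for T: uniqueness does not
-- presuppose that P is the suffix array of the competing string.
record DeterminedBy {n : ℕ} (k x y : ℕ) (T : Word n) : Set where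
  field
    attained : Σ (Permutation′ n) λ P → Σ ℕ λ s →
               IsSuffixArray T P × ArithProgressed k P × HasForm T P s ×
               P [ 1 ]≡ x × P [ s ]≡ y
    unique   : (T′ : Word n) (P : Permutation′ n) (s : ℕ) →
               ArithProgressed k P → HasForm T′ P s →
               P [ 1 ]≡ x → P [ s ]≡ y → T′ ≡ T

record HasPeriod {n : ℕ} (p : ℕ) (T : Word n) : Set where
  field
    1≤p    : 1 ≤ p
    p≤n-1  : p ≤ n ∸ 1
    repeat : (i j : Fin n) → pos j ≡ pos i + p → lookup T i ≡ lookup T j

-- “Other” rotations are those by r ∈ [1..n-1], even if equal to T as strings,
-- so Lyndon words are primitive.
IsLyndon : {n : ℕ} → Word n → Set
IsLyndon {n} T = (r : ℕ) → 1 ≤ r → r < n →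
  toList T ≺ drop r (toList T) ++ take r (toList T)

-- Write p_{i+1} = p_i + k (mod n). Suffixes of neighbouring ranks start at x and x + k; if their
-- first letters agree, their order is that of the suffixes at x + 1 and x + k + 1, again of
-- neighbouring ranks unless x + k = n (the second suffix becomes empty) or x + 1 = p_n. In
-- these two situations the order is reversed, so the letter must change there: p_s = n - k
-- unless p_1 = n, and p_s = p_n - 1 unless p_n = 1. Everywhere else the comparison descends
-- to shorter suffixes, so these conditions are also sufficient. As p_1 = p_n + k (mod n) and
-- k < n - 1, they leave exactly three pairs (p_1, p_s).
module Submission where

open import Defs
open import Data.Fin as Fin using (Fin; zero; suc; toℕ; fromℕ; fromℕ<; inject₁; punchOut)
open import Data.Fin.Permutation using (Permutation′; _⟨$⟩ʳ_; _⟨$⟩ˡ_; permutation; inverseˡ; inverseʳ)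
open import Data.Fin.Properties
  using (toℕ-injective; toℕ<n; toℕ-fromℕ; toℕ-fromℕ<; fromℕ<-injective; toℕ-inject₁; ≤fromℕ; any?;
         punchOut-injective; injective⇒≤)
open import Data.List using ([]; _∷_; drop; take; length; _++_)
open import Data.List.Properties using (length-drop)
open import Data.List.Relation.Binary.Lex.Strict using (halt; this; next; xs≮[]; <-transitive; <-asymmetric)
open import Data.Nat
  using (ℕ; zero; suc; _+_; _*_; _∸_; _≤_; _<_; _%_; _/_; z≤n; s≤s; z<s; _≟_; _≤?_; _<?_)
open import Data.Nat.Coprimality as Coprimality using (Coprime; coprime-divisor)
open import Data.Nat.Divisibility using (_∣_; divides; ∣m+n∣m⇒∣n; ∣⇒≤)
open import Data.Nat.DivMod
  using (m≡m%n+[m/n]*n; m%n<n; m<n⇒m%n≡m; [m+n]%n≡m%n; [m+kn]%n≡m%n; %-pred-≡0;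
         m<[1+n%d]⇒m≤[n%d]; [1+m%d]≤1+n⇒[m%d]≤n)
open import Data.Nat.Properties
open import Data.Product using (Σ; ∃; _×_; _,_; proj₁; proj₂)
open import Data.Sum using (_⊎_; inj₁; inj₂)
open import Data.Vec using ([]; _∷_; lookup; tabulate; toList)
open import Data.Vec.Properties using (lookup∘tabulate; tabulate∘lookup; tabulate-cong)
open import Function using (_∘_)
open import Function.Bundles using (_⇔_; mk⇔)
open import Function.Definitions using (Injective)
open import Relation.Binary.Definitions using (tri<; tri≈; tri>)
open import Relation.Binary.PropositionalEquality
open import Relation.Nullary using (¬_; Dec; yes; no; contradiction)

-- Lexicographic comparison of suffixes.

≺-trans : ∀ {us vs ws} → us ≺ vs → vs ≺ ws → us ≺ ws
≺-trans = <-transitive isEquivalence (resp₂ _<ᴸ_) λ { a<b () }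

≺-asym : ∀ {us vs} → us ≺ vs → ¬ vs ≺ us
≺-asym = <-asymmetric sym (resp₂ _<ᴸ_) λ { a<b () }

≺-++ʳ : ∀ {us vs} ws → length vs ≤ length us → us ≺ vs → us ≺ vs ++ ws
≺-++ʳ ws _        (this u<v)       = this u<v
≺-++ʳ ws (s≤s le) (next u≡v us≺vs) = next u≡v (≺-++ʳ ws le us≺vs)

suffix-∷ : ∀ {n} (T : Word n) i → suffix T i ≡ lookup T i ∷ drop (pos i) (toList T)
suffix-∷ (c ∷ T) zero    = refl
suffix-∷ (c ∷ T) (suc i) = suffix-∷ T i

drop-all : ∀ {n} (T : Word n) → drop n (toList T) ≡ []
drop-all []      = refl
drop-all (c ∷ T) = drop-all T

module _ {n} (T : Word n) {i j : Fin n} where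

  ≺-break : lookup T i ≡ a → lookup T j ≡ b → suffix T i ≺ suffix T j
  ≺-break eqᵃ eqᵇ rewrite suffix-∷ T i | suffix-∷ T j | eqᵃ | eqᵇ = this a<b

  ≺-cons : lookup T i ≡ lookup T j → drop (pos i) (toList T) ≺ drop (pos j) (toList T) →
           suffix T i ≺ suffix T j
  ≺-cons eq lt rewrite suffix-∷ T i | suffix-∷ T j = next eq lt

  ≺-uncons : suffix T i ≺ suffix T j →
             (lookup T i ≡ a × lookup T j ≡ b) ⊎
             (lookup T i ≡ lookup T j × drop (pos i) (toList T) ≺ drop (pos j) (toList T))
  ≺-uncons lt rewrite suffix-∷ T i | suffix-∷ T j with lookup T i | lookup T j | lt
  ... | _ | _ | this a<b   = inj₁ (refl , refl)
  ... | _ | _ | next eq gt = inj₂ (eq , gt)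

≡-by-lookup : ∀ {n} (T U : Word n) → (∀ i → lookup T i ≡ lookup U i) → T ≡ U
≡-by-lookup T U eq = trans (sym (tabulate∘lookup T)) (trans (tabulate-cong eq) (tabulate∘lookup U))

-- Neighbouring ranks and finite permutations.

Next : ∀ {n} → Fin n → Fin n → Set
Next i j = toℕ j ≡ suc (toℕ i)

next? : ∀ {m} (i : Fin (suc m)) → i ≡ fromℕ m ⊎ ∃ (Next i)
next? {m} i with suc (toℕ i) <? suc m
... | yes lt = inj₂ (fromℕ< lt , toℕ-fromℕ< lt)
... | no ¬lt = inj₁ (toℕ-injective (trans i≡m (sym (toℕ-fromℕ m))))
  where
  i≡m : toℕ i ≡ m
  i≡m = suc-injective (≤-antisym (toℕ<n i) (≮⇒≥ ¬lt))

prev? : ∀ {m} (j : Fin (suc m)) → j ≡ zero ⊎ ∃ λ i → Next i j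
prev? zero    = inj₁ refl
prev? (suc i) = inj₂ (inject₁ i , cong suc (sym (toℕ-inject₁ i)))

¬next-last : ∀ {m} {j : Fin (suc m)} → ¬ Next (fromℕ m) j
¬next-last {m} {j} eq = <-irrefl (trans eq (cong suc (toℕ-fromℕ m))) (toℕ<n j)

next-chain : ∀ {n} (_R_ : Fin n → Fin n → Set) → (∀ {i j l} → i R j → j R l → i R l) →
             (∀ i j → Next i j → i R j) → ∀ i j → i Fin.< j → i R j
next-chain {n} _R_ R-trans R-next i j i<j = go _ j (sym (m+[n∸m]≡n i<j))
  where
  go : ∀ d j → toℕ j ≡ pos i + d → i R j
  go zero    j eq = R-next i j (trans eq (+-identityʳ _))
  go (suc d) j eq = R-trans (go d j′ eq′)
    (R-next j′ j (trans eq (trans (+-suc _ d) (cong suc (sym eq′)))))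
    where
    lt : pos i + d < n
    lt = <-trans (subst (_≤ toℕ j) (+-suc _ d) (≤-reflexive (sym eq))) (toℕ<n j)
    j′ = fromℕ< lt
    eq′ = toℕ-fromℕ< lt

injective⇒permutation : ∀ {n} (f : Fin n → Fin n) → Injective _≡_ _≡_ f →
                        Σ (Permutation′ n) λ P → ∀ i → P ⟨$⟩ʳ i ≡ f i
injective⇒permutation {zero}  f _     = permutation f f (λ ()) (λ ()) , λ _ → refl
injective⇒permutation {suc m} f f-inj =
  permutation f (proj₁ ∘ surj) (proj₂ ∘ surj) (λ i → f-inj (proj₂ (surj (f i)))) , λ _ → refl
  where
  surj : ∀ y → ∃ λ i → f i ≡ y
  surj y with any? (λ i → f i Fin.≟ y)
  ... | yes hit = hit
  -- If `y` were missed, removing it from the codomain would give an injection of `Fin (suc m)` into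
  -- `Fin m`.
  ... | no ¬hit = contradiction (injective⇒≤ {f = g} g-inj) (<-irrefl refl)
    where
    y≢f : ∀ i → y ≢ f i
    y≢f i eq = ¬hit (i , sym eq)
    g : Fin (suc m) → Fin m
    g i = punchOut (y≢f i)
    g-inj : Injective _≡_ _≡_ g
    g-inj {i} {j} = f-inj ∘ punchOut-injective (y≢f i) (y≢f j)

⟨$⟩ʳ-injective : ∀ {n} (P : Permutation′ n) {i j} → P ⟨$⟩ʳ i ≡ P ⟨$⟩ʳ j → i ≡ j
⟨$⟩ʳ-injective P eq = trans (sym (inverseˡ P)) (trans (cong (P ⟨$⟩ˡ_) eq) (inverseˡ P))

rank : ∀ {n} (P : Permutation′ n) {x} → x < n → ∃ λ i → toℕ (P ⟨$⟩ʳ i) ≡ x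
rank P x<n = P ⟨$⟩ˡ fromℕ< x<n , trans (cong toℕ (inverseʳ P)) (toℕ-fromℕ< x<n)

entry : ∀ {n} (P : Permutation′ n) {i x} → P [ pos i ]≡ suc x → toℕ (P ⟨$⟩ʳ i) ≡ x
entry P {i} {x} (i′ , eqⁱ , eqˣ) =
  subst (λ i → toℕ (P ⟨$⟩ʳ i) ≡ x) (toℕ-injective (suc-injective eqⁱ)) (suc-injective eqˣ)

-- Cyclic shifts of positions.

-- Addition of k modulo n on [0..n-1].
data Shift (n k x y : ℕ) : Set where
  direct  : x + k ≡ y → Shift n k x y
  wrapped : x + k ≡ y + n → Shift n k x y

module _ {n k : ℕ} where

  private
    noWrap : ∀ {y z} → y ≡ z + n → ¬ y < n
    noWrap {z = z} refl = ≤⇒≯ (m≤n+m n z)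

  Shift-functional : ∀ {x y y′} → y < n → y′ < n → Shift n k x y → Shift n k x y′ → y ≡ y′
  Shift-functional lt lt′ (direct p)  (direct q)  = trans (sym p) q
  Shift-functional lt lt′ (direct p)  (wrapped q) = contradiction lt (noWrap (trans (sym p) q))
  Shift-functional lt lt′ (wrapped p) (direct q)  = contradiction lt′ (noWrap (trans (sym q) p))
  Shift-functional lt lt′ (wrapped p) (wrapped q) = +-cancelʳ-≡ n _ _ (trans (sym p) q)

  Shift-injective : ∀ {x x′ y} → x < n → x′ < n → Shift n k x y → Shift n k x′ y → x ≡ x′
  Shift-injective {x} {x′} {y} lt lt′ s s′ = go s s′
    where
    -- When only one of the two additions wraps, the starting points differ by n, which is
    -- impossible below n.
    lap : ∀ {x x′} → x + k ≡ y → x′ + k ≡ y + n → x′ ≡ x + n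
    lap {x} {x′} p q = +-cancelʳ-≡ k _ _ (begin
      x′ + k       ≡⟨ q ⟩
      y + n        ≡⟨ cong (_+ n) (sym p) ⟩
      x + k + n    ≡⟨ +-assoc x k n ⟩
      x + (k + n)  ≡⟨ cong (x +_) (+-comm k n) ⟩
      x + (n + k)  ≡⟨ sym (+-assoc x n k) ⟩
      x + n + k    ∎)
      where open ≡-Reasoning
    go : Shift n k x y → Shift n k x′ y → x ≡ x′
    go (direct p)  (direct q)  = +-cancelʳ-≡ k _ _ (trans p (sym q))
    go (direct p)  (wrapped q) = contradiction lt′ (noWrap (lap p q))
    go (wrapped p) (direct q)  = contradiction lt (noWrap (lap q p))
    go (wrapped p) (wrapped q) = +-cancelʳ-≡ k _ _ (trans p (sym q))

  -- Dropping the first letter of two suffixes keeps their starting points k apart, which lets the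
  -- comparison descend.
  Shift-suc : ∀ {x y} → Shift n k x y → Shift n k (suc x) (suc y)
  Shift-suc (direct p)  = direct (cong suc p)
  Shift-suc (wrapped p) = wrapped (cong suc p)

Shift-% : ∀ {m k x} → k < suc m → x < suc m → Shift (suc m) k x ((x + k) % suc m)
Shift-% {m} {k} {x} k<n x<n with x + k <? suc m
... | yes lt = direct (sym (m<n⇒m%n≡m lt))
... | no ¬lt = wrapped (trans (sym z+n) (cong (_+ suc m) (sym eq)))
  where
  z = x + k ∸ suc m
  z+n : z + suc m ≡ x + k
  z+n = m∸n+n≡m (≮⇒≥ ¬lt)
  z<n : z < suc m
  z<n = +-cancelʳ-< (suc m) z (suc m) (subst (_< suc m + suc m) (sym z+n) (+-mono-< x<n k<n))
  eq : (x + k) % suc m ≡ z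
  eq = trans (cong (_% suc m) (sym z+n)) (trans ([m+n]%n≡m%n z (suc m)) (m<n⇒m%n≡m z<n))

-- Translates the 1-based representatives of `step` into the 0-based residues of `Shift`. In the
-- case of residue 0 the representative is n, and the preceding residue is n - 1.
suc-mod : ∀ z m → (suc z mod suc m) ≡ suc (z % suc m)
suc-mod z m with suc z % suc m in eq
... | zero  = cong suc (sym (%-pred-≡0 {z} eq))
... | suc r = cong suc (≤-antisym
  (m<[1+n%d]⇒m≤[n%d] z (suc m) (≤-reflexive (sym eq)))
  ([1+m%d]≤1+n⇒[m%d]≤n z r (suc m) (subst (0 <_) (sym eq) z<s) (≤-reflexive eq)))

-- Letters in the order of rank, and the first suffix.

module _ {m s : ℕ} {T : Word (suc m)} {P : Permutation′ (suc m)} (form : HasForm T P s) where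
  open HasForm form

  letter-a : ∀ {i} → pos i ≤ s → lookup T (P ⟨$⟩ʳ i) ≡ a
  letter-a {i} le = inside _ (i , le , refl)

  letter-b : ∀ {i} → s < pos i → lookup T (P ⟨$⟩ʳ i) ≡ b
  letter-b {i} lt = outside _ λ { (j , le , eq) →
    <⇒≱ lt (subst (λ i → pos i ≤ s) (⟨$⟩ʳ-injective P eq) le) }

  -- In the order of rank the letters form a block of a's followed by a block of b's, and the
  -- boundary comes right after rank s.
  letter-next : ∀ {i j} → Next i j → pos i ≢ s → lookup T (P ⟨$⟩ʳ i) ≡ lookup T (P ⟨$⟩ʳ j)
  letter-next {i} {j} nx ne with <-cmp (pos i) s
  ... | tri< lt _ _ = trans (letter-a (<⇒≤ lt)) (sym (letter-a (subst (_≤ s) (cong suc (sym nx)) lt)))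
  ... | tri≈ _ eq _ = contradiction eq ne
  ... | tri> _ _ gt = trans (letter-b gt)
                        (sym (letter-b (<-trans gt (≤-reflexive (cong suc (sym nx))))))

first-smallest : ∀ {m} (T : Word (suc m)) P → IsSuffixArray T P → ∀ x →
                 x ≡ P ⟨$⟩ʳ zero ⊎ suffix T (P ⟨$⟩ʳ zero) ≺ suffix T x
first-smallest T P sa x with P ⟨$⟩ˡ x in eq
... | zero  = inj₁ (trans (sym (inverseʳ P)) (cong (P ⟨$⟩ʳ_) eq))
... | suc i = inj₂ (subst (λ x → suffix T (P ⟨$⟩ʳ zero) ≺ suffix T x)
                (trans (cong (P ⟨$⟩ʳ_) (sym eq)) (inverseʳ P)) (sa zero (suc i) z<s))

-- The smallest suffix depends on the word alone. This later separates the three words by their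
-- values of p₁.
first-unique : ∀ {m} (T : Word (suc m)) P Q → IsSuffixArray T P → IsSuffixArray T Q →
               P ⟨$⟩ʳ zero ≡ Q ⟨$⟩ʳ zero
first-unique T P Q saP saQ
  with first-smallest T P saP (Q ⟨$⟩ʳ zero) | first-smallest T Q saQ (P ⟨$⟩ʳ zero)
... | inj₁ eq | _       = sym eq
... | inj₂ _  | inj₁ eq = eq
... | inj₂ lt | inj₂ gt = contradiction gt (≺-asym lt)

-- Arithmetically progressed permutations as suffix arrays.

module _ {m k : ℕ} {P : Permutation′ (suc m)} (ap : ArithProgressed k P) where
  open ArithProgressed ap

  private
    n = suc m
    q : Fin n → ℕ
    q i = toℕ (P ⟨$⟩ʳ i)
    q<n : ∀ i → q i < n
    q<n i = toℕ<n (P ⟨$⟩ʳ i)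
    q-injective : ∀ {i j} → q i ≡ q j → i ≡ j
    q-injective = ⟨$⟩ʳ-injective P ∘ toℕ-injective
    k<n : k < n
    k<n = s≤s k≤n-1

  ap-shift : ∀ {i j} → Next i j → Shift n k (q i) (q j)
  ap-shift {i} {j} nx = subst (Shift n k (q i)) (sym eq) (Shift-% k<n (q<n i))
    where
    eq : q j ≡ (q i + k) % n
    eq = suc-injective (trans (step i j (cong suc nx)) (suc-mod (q i + k) m))

  -- `step` is silent about the last rank. Its shifted value has some rank `r`; a predecessor of `r`
  -- would have the same shift, hence be the last rank, which has no successor.
  ap-wrap : Shift n k (q (fromℕ m)) (q zero)
  ap-wrap with rank P (m%n<n (q (fromℕ m) + k) n)
  ... | r , eq with subst (Shift n k (q (fromℕ m))) (sym eq) (Shift-% k<n (q<n (fromℕ m))) | prev? r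
  ...   | sh | inj₁ refl     = sh
  ...   | sh | inj₂ (i , nx) with q-injective (Shift-injective (q<n i) (q<n (fromℕ m)) (ap-shift nx) sh)
  ...     | refl = contradiction nx ¬next-last

  ap-last : ∀ {l} → l < n → Shift n k l (q zero) → q (fromℕ m) ≡ l
  ap-last l<n sh = Shift-injective (q<n (fromℕ m)) l<n ap-wrap sh

  -- For neighbouring ranks the comparison of the suffixes at x and x + k passes to
  -- x + 1 and x + 1 + k, which are neighbouring ranks again except where the
  -- hypotheses place the letter change.
  sorted : ∀ {T s} → HasForm T P s →
           (∀ i → suc (q i) ≡ q (fromℕ m) → pos i ≡ s) →
           (∀ i j → Next i j → q j ≡ m → pos i ≡ s) →
           IsSuffixArray T P
  sorted {T} {s} form atLast atEnd =
    next-chain (λ i j → suffix T (P ⟨$⟩ʳ i) ≺ suffix T (P ⟨$⟩ʳ j)) ≺-trans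
      (λ i j nx → adjacent n i j nx (m≤m+n n (q i)))
    where
    -- The fuel bounds the length of the first suffix: each descent moves its start one position to
    -- the right.
    adjacent : ∀ fuel i j → Next i j → n ≤ fuel + q i →
               suffix T (P ⟨$⟩ʳ i) ≺ suffix T (P ⟨$⟩ʳ j)
    adjacent zero       i j nx le = contradiction (q<n i) (≤⇒≯ le)
    adjacent (suc fuel) i j nx le with pos i ≟ s
    ... | yes refl =
      ≺-break T (letter-a form ≤-refl) (letter-b form (≤-reflexive (cong suc (sym nx))))
    ... | no pos≢s =
      ≺-cons T (letter-next form nx pos≢s) (tails (suc (q i) <? n) (suc (q j) <? n))
      where
      tails : Dec (suc (q i) < n) → Dec (suc (q j) < n) →
              drop (suc (q i)) (toList T) ≺ drop (suc (q j)) (toList T)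
      -- The second suffix is a single letter, so the letter change is here.
      tails _ (no ¬lt) = contradiction (atEnd i j nx q≡m) pos≢s
        where
        q≡m : q j ≡ m
        q≡m = ≤-antisym (≤-pred (q<n j)) (≤-pred (≮⇒≥ ¬lt))
      tails (no ¬lt) (yes lt)
        rewrite ≤-antisym (q<n i) (≮⇒≥ ¬lt) | drop-all T
        with rank P lt
      ... | r , eq =
        subst (λ x → [] ≺ drop x (toList T)) eq (subst ([] ≺_) (sym (suffix-∷ T (P ⟨$⟩ʳ r))) halt)
      tails (yes lt) (yes lt′) with rank P lt
      ... | i′ , eq with next? i′
      -- Here x + 1 is p_n, the one position without a next rank.
      ...   | inj₁ refl        = contradiction (atLast i (sym eq)) pos≢s
      ...   | inj₂ (j′ , nx′) =
        -- The rank after that of x + 1 holds x + 1 + k, and this is the position following that of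
        -- rank `j`.
        subst₂ (λ x y → drop x (toList T) ≺ drop y (toList T)) eq
          (Shift-functional (q<n j′) lt′ (ap-shift nx′)
            (subst (λ x → Shift n k x (suc (q j))) (sym eq) (Shift-suc (ap-shift nx))))
          (adjacent fuel i′ j′ nx′
            (≤-trans le (≤-reflexive (trans (sym (+-suc fuel (q i))) (cong (fuel +_) (sym eq))))))

  module _ {T : Word n} {s e : ℕ} (form : HasForm T P s) (p-s : P [ s ]≡ suc e) where

    -- Adding k to a position passes to the next rank. This fails only at p_n, and the letter
    -- changes only after p_s.
    letter-shift : ∀ {x y} → Shift n k (toℕ x) (toℕ y) → toℕ x ≢ q (fromℕ m) → toℕ x ≢ e →
                   lookup T x ≡ lookup T y
    letter-shift {x} {y} sh x≢last x≢e with rank P (toℕ<n x)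
    ... | i , eq with next? i
    ...   | inj₁ refl      = contradiction (sym eq) x≢last
    ...   | inj₂ (j , nx) =
      subst₂ (λ x y → lookup T x ≡ lookup T y) (toℕ-injective eq) (toℕ-injective eq′)
        (letter-next form nx pos≢s)
      where
      eq′ : q j ≡ toℕ y
      eq′ = Shift-functional (q<n j) (toℕ<n y) (ap-shift nx)
              (subst (λ x → Shift n k x (toℕ y)) (sym eq) sh)
      pos≢s : pos i ≢ s
      pos≢s refl = x≢e (trans (sym eq) (entry P p-s))

ap-unique : ∀ {m k} {P Q : Permutation′ (suc m)} → ArithProgressed k P → ArithProgressed k Q →
            P ⟨$⟩ʳ zero ≡ Q ⟨$⟩ʳ zero → ∀ i → P ⟨$⟩ʳ i ≡ Q ⟨$⟩ʳ i
ap-unique {m} {k} {P} {Q} apP apQ eq₀ i = go (toℕ i) i refl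
  where
  go : ∀ r i → toℕ i ≡ r → P ⟨$⟩ʳ i ≡ Q ⟨$⟩ʳ i
  go r i eq with prev? i
  ... | inj₁ refl = eq₀
  go zero    i eq | inj₂ (j , nx) = contradiction (trans (sym eq) nx) λ ()
  go (suc r) i eq | inj₂ (j , nx) = toℕ-injective
    (Shift-functional (toℕ<n _) (toℕ<n _) (ap-shift apP nx)
      (subst (λ x → Shift (suc m) k (toℕ x) (toℕ (Q ⟨$⟩ʳ i)))
        (sym (go r j (suc-injective (trans (sym nx) eq)))) (ap-shift apQ nx)))

form-unique : ∀ {m s} {T U : Word (suc m)} {P Q} → HasForm T P s → HasForm U Q s →
              (∀ i → P ⟨$⟩ʳ i ≡ Q ⟨$⟩ʳ i) → T ≡ U
form-unique {s = s} {T} {U} {P} {Q} formT formU eq = ≡-by-lookup T U λ x →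
  subst (λ x → lookup T x ≡ lookup U x) (inverseʳ P) (agree (P ⟨$⟩ˡ x))
  where
  agree : ∀ i → lookup T (P ⟨$⟩ʳ i) ≡ lookup U (P ⟨$⟩ʳ i)
  agree i with pos i ≤? s
  ... | yes le = trans (letter-a formT le) (sym (trans (cong (lookup U) (eq i)) (letter-a formU le)))
  ... | no ¬le = trans (letter-b formT (≰⇒> ¬le))
                   (sym (trans (cong (lookup U) (eq i)) (letter-b formU (≰⇒> ¬le))))

-- Construction of words and progressions.

letterAt : {P : Set} → Dec P → Letter
letterAt (yes _) = a
letterAt (no _)  = b

wordOf : ∀ {n} → Permutation′ n → ℕ → Word n
wordOf P s = tabulate λ x → letterAt (pos (P ⟨$⟩ˡ x) ≤? s)

wordOf-form : ∀ {n} (P : Permutation′ n) s → 1 ≤ s → s ≤ n ∸ 1 → HasForm (wordOf P s) P s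
wordOf-form {n} P s 1≤s s≤n-1 = record
  { 1≤s     = 1≤s
  ; s≤n-1   = s≤n-1
  ; inside  = λ { x (i , le , refl) →
      trans (lookup∘tabulate _ x) (isA (subst (λ i → pos i ≤ s) (sym (inverseˡ P)) le)) }
  ; outside = λ x ¬first →
      trans (lookup∘tabulate _ x) (isB λ le → ¬first (P ⟨$⟩ˡ x , le , inverseʳ P))
  }
  where
  isA : ∀ {r} → r ≤ s → letterAt (r ≤? s) ≡ a
  isA {r} le with r ≤? s
  ... | yes _  = refl
  ... | no ¬le = contradiction le ¬le
  isB : ∀ {r} → ¬ r ≤ s → letterAt (r ≤? s) ≡ b
  isB {r} ¬le with r ≤? s
  ... | yes le = contradiction le ¬le
  ... | no _   = refl

-- Equal residues make n divide (j - i)k, hence j - i by coprimality; but j - i is below n and so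
-- must be 0.
multiples-injective : ∀ {m k} → Coprime k (suc m) → ∀ u {i j} → i ≤ j → j < suc m →
                      (u + i * k) % suc m ≡ (u + j * k) % suc m → i ≡ j
multiples-injective {m} {k} cop u {i} {j} i≤j j<n eq = go (j ∸ i) refl
  where
  n = suc m
  v = u + i * k
  d = j ∸ i
  v+dk : u + j * k ≡ v + k * d
  v+dk = begin
    u + j * k             ≡⟨ cong (λ j → u + j * k) (sym (m+[n∸m]≡n i≤j)) ⟩
    u + (i + d) * k       ≡⟨ cong (u +_) (*-distribʳ-+ k i d) ⟩
    u + (i * k + d * k)   ≡⟨ sym (+-assoc u (i * k) (d * k)) ⟩
    v + d * k             ≡⟨ cong (v +_) (*-comm d k) ⟩
    v + k * d             ∎
    where open ≡-Reasoning
  quotients : v / n * n + k * d ≡ (u + j * k) / n * n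
  quotients = +-cancelˡ-≡ (v % n) _ _ (begin
    v % n + (v / n * n + k * d)                 ≡⟨ sym (+-assoc (v % n) _ _) ⟩
    v % n + v / n * n + k * d                   ≡⟨ cong (_+ k * d) (sym (m≡m%n+[m/n]*n v n)) ⟩
    v + k * d                                   ≡⟨ sym v+dk ⟩
    u + j * k                                   ≡⟨ m≡m%n+[m/n]*n (u + j * k) n ⟩
    (u + j * k) % n + (u + j * k) / n * n       ≡⟨ cong (_+ (u + j * k) / n * n) (sym eq) ⟩
    v % n + (u + j * k) / n * n                 ∎)
    where open ≡-Reasoning
  n∣d : n ∣ d
  n∣d = coprime-divisor (Coprimality.sym cop)
          (∣m+n∣m⇒∣n (divides ((u + j * k) / n) quotients) (divides (v / n) refl))
  go : ∀ d′ → d ≡ d′ → i ≡ j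
  go zero     eqᵈ = ≤-antisym i≤j (m∸n≡0⇒m≤n eqᵈ)
  go (suc d′) eqᵈ = contradiction (∣⇒≤ (subst (n ∣_) eqᵈ n∣d))
                      (<⇒≱ (subst (_< n) eqᵈ (≤-<-trans (m∸n≤m j i) j<n)))

-- The recurrence is solved by p + ik modulo n, and coprimality makes these values distinct.
progression : ∀ {m k} → 1 ≤ k → k ≤ m → Coprime k (suc m) → (p : Fin (suc m)) →
              Σ (Permutation′ (suc m)) λ P → ArithProgressed k P × P ⟨$⟩ʳ zero ≡ p
progression {m} {k} 1≤k k≤m cop p with injective⇒permutation f f-injective
  where
  n = suc m
  f : Fin n → Fin n
  f i = fromℕ< (m%n<n (toℕ p + toℕ i * k) n)
  f-injective : Injective _≡_ _≡_ f
  f-injective {i} {j} eq with ≤-total (toℕ i) (toℕ j) | fromℕ<-injective _ _ _ _ eq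
  ... | inj₁ le | eq′ = toℕ-injective (multiples-injective cop (toℕ p) le (toℕ<n j) eq′)
  ... | inj₂ ge | eq′ = toℕ-injective (sym (multiples-injective cop (toℕ p) ge (toℕ<n i) (sym eq′)))
... | P , P≡f = P , record { 1≤k = 1≤k ; k≤n-1 = k≤m ; step = step } , toℕ-injective (begin
  toℕ (P ⟨$⟩ʳ zero)  ≡⟨ value zero ⟩
  (toℕ p + 0) % n    ≡⟨ cong (_% n) (+-identityʳ (toℕ p)) ⟩
  toℕ p % n          ≡⟨ m<n⇒m%n≡m (toℕ<n p) ⟩
  toℕ p              ∎)
  where
  open ≡-Reasoning
  n = suc m
  value : ∀ i → toℕ (P ⟨$⟩ʳ i) ≡ (toℕ p + toℕ i * k) % n
  value i = trans (cong toℕ (P≡f i)) (toℕ-fromℕ< _)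
  step : ∀ i j → pos j ≡ suc (pos i) → pos (P ⟨$⟩ʳ j) ≡ (pos (P ⟨$⟩ʳ i) + k) mod n
  step i j eq = begin
    suc (toℕ (P ⟨$⟩ʳ j))                 ≡⟨ cong suc (value j) ⟩
    suc ((toℕ p + toℕ j * k) % n)        ≡⟨ cong (λ j → suc ((toℕ p + j * k) % n)) (suc-injective eq) ⟩
    suc ((toℕ p + (k + toℕ i * k)) % n)  ≡⟨ cong (λ z → suc (z % n)) shuffle ⟩
    suc ((u % n + k + u / n * n) % n)    ≡⟨ cong suc ([m+kn]%n≡m%n (u % n + k) (u / n) n) ⟩
    suc ((u % n + k) % n)                ≡⟨ sym (suc-mod (u % n + k) m) ⟩
    suc (u % n + k) mod n                ≡⟨ cong (λ x → suc (x + k) mod n) (sym (value i)) ⟩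
    (pos (P ⟨$⟩ʳ i) + k) mod n           ∎
    where
    u = toℕ p + toℕ i * k
    shuffle : toℕ p + (k + toℕ i * k) ≡ u % n + k + u / n * n
    shuffle = begin
      toℕ p + (k + toℕ i * k)   ≡⟨ cong (toℕ p +_) (+-comm k (toℕ i * k)) ⟩
      toℕ p + (toℕ i * k + k)   ≡⟨ sym (+-assoc (toℕ p) _ k) ⟩
      u + k                     ≡⟨ cong (_+ k) (m≡m%n+[m/n]*n u n) ⟩
      u % n + u / n * n + k     ≡⟨ +-assoc (u % n) _ k ⟩
      u % n + (u / n * n + k)   ≡⟨ cong (u % n +_) (+-comm _ k) ⟩
      u % n + (k + u / n * n)   ≡⟨ sym (+-assoc (u % n) k _) ⟩
      u % n + k + u / n * n     ∎

-- Sufficiency of the conditions on the letter change.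

-- p, l and e are p₁ - 1, pₙ - 1 and pₛ - 1; atLast and atEnd say that the letter
-- changes after rank s where the order of the shorter suffixes does not decide.
record Admissible (m k p l e : ℕ) : Set where
  field
    p<n    : p < suc m
    l<n    : l < suc m
    e<n    : e < suc m
    wrap   : Shift (suc m) k l p
    e≢l    : e ≢ l
    atLast : l ≡ 0 ⊎ l ≡ suc e
    atEnd  : p ≡ m ⊎ e + k ≡ m

-- The permutation is fixed by k and p, and s is then the rank of e. The admissibility conditions
-- are those that `sorted` asks for.
determined : ∀ {m k p l e} → 1 ≤ k → k ≤ m → Coprime k (suc m) → Admissible m k p l e →
             Σ (Word (suc m)) (DeterminedBy k (suc p) (suc e))
determined {m} {k} {p} {l} {e} 1≤k k≤m cop adm
  with progression 1≤k k≤m cop (fromℕ< p<n)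
  where open Admissible adm
... | P , ap , P₀ = wordOf P s , record
  { attained = P , s , sorted ap form isLast isEnd , ap , form
             , (zero , refl , cong suc q₀) , (i , refl , cong suc qᵢ)
  ; unique   = unique
  }
  where
  open Admissible adm
  q₀ : toℕ (P ⟨$⟩ʳ zero) ≡ p
  q₀ = trans (cong toℕ P₀) (toℕ-fromℕ< p<n)
  i = proj₁ (rank P e<n)
  qᵢ : toℕ (P ⟨$⟩ʳ i) ≡ e
  qᵢ = proj₂ (rank P e<n)
  s = pos i
  qₗ : toℕ (P ⟨$⟩ʳ fromℕ m) ≡ l
  qₗ = ap-last ap l<n (subst (Shift (suc m) k l) (sym q₀) wrap)
  rank-e : ∀ {i′} → toℕ (P ⟨$⟩ʳ i′) ≡ e → i′ ≡ i
  rank-e eq = ⟨$⟩ʳ-injective P (toℕ-injective (trans eq (sym qᵢ)))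
  -- As `e≢l`, the rank of e is not the last one, so at least one b remains.
  s≤m : s ≤ m
  s≤m with next? i
  ... | inj₁ i≡last   = contradiction (trans (sym qᵢ) (trans (cong (toℕ ∘ (P ⟨$⟩ʳ_)) i≡last) qₗ)) e≢l
  ... | inj₂ (j , nx) = subst (_≤ m) nx (≤-pred (toℕ<n j))
  form = wordOf-form P s (s≤s z≤n) s≤m
  -- Either p_n = 1 and no position precedes it, or the preceding one is p_s.
  isLast : ∀ i′ → suc (toℕ (P ⟨$⟩ʳ i′)) ≡ toℕ (P ⟨$⟩ʳ fromℕ m) → pos i′ ≡ s
  isLast i′ eq with atLast
  ... | inj₁ refl = contradiction (trans eq qₗ) λ ()
  ... | inj₂ refl = cong pos (rank-e (suc-injective (trans eq qₗ)))
  -- Either position n has the first rank and no rank precedes it, or p_s is the only position that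
  -- the shift takes to n.
  isEnd : ∀ i′ j → Next i′ j → toℕ (P ⟨$⟩ʳ j) ≡ m → pos i′ ≡ s
  isEnd i′ j nx eq with atEnd
  ... | inj₁ p≡m   = contradiction (trans (sym nx) (cong toℕ j≡0)) λ ()
    where
    j≡0 : j ≡ zero
    j≡0 = ⟨$⟩ʳ-injective P (toℕ-injective (trans eq (sym (trans q₀ p≡m))))
  ... | inj₂ e+k≡m = cong pos (rank-e (Shift-injective (toℕ<n _) e<n
                       (subst (Shift (suc m) k (toℕ (P ⟨$⟩ʳ i′))) eq (ap-shift ap nx)) (direct e+k≡m)))
  unique : ∀ T′ P′ s′ → ArithProgressed k P′ → HasForm T′ P′ s′ →
           P′ [ 1 ]≡ suc p → P′ [ s′ ]≡ suc e → T′ ≡ wordOf P s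
  unique T′ P′ s′ ap′ form′ p-1 (i′ , refl , eqᵉ) =
    form-unique (subst (HasForm T′ P′) (cong pos i′≡i) form′) form same
    where
    same = ap-unique ap′ ap (toℕ-injective (trans (entry P′ p-1) (sym q₀)))
    i′≡i = rank-e (trans (sym (cong toℕ (same i′))) (suc-injective eqᵉ))

-- Necessity: where the letter must change.

Break : ∀ {n} → Word n → Permutation′ n → Fin n → Fin n → Set
Break T P i j = Next i j × lookup T (P ⟨$⟩ʳ i) ≡ a × lookup T (P ⟨$⟩ʳ j) ≡ b

module _ {m : ℕ} (T : Word (suc m)) (P : Permutation′ (suc m)) (sa : IsSuffixArray T P) where

  private
    a≢b : ∀ {c} → c ≡ a → c ≢ b
    a≢b refl ()
    a⊎b : ∀ c → c ≡ a ⊎ c ≡ b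
    a⊎b a = inj₁ refl
    a⊎b b = inj₂ refl

  -- Comparison looks at first letters first, so no suffix starting with b precedes one starting
  -- with a.
  letters-sorted : ∀ {i j} → i Fin.≤ j → lookup T (P ⟨$⟩ʳ j) ≡ a → lookup T (P ⟨$⟩ʳ i) ≡ a
  letters-sorted {i} {j} i≤j eq with m≤n⇒m<n∨m≡n i≤j
  ... | inj₂ i≡j = trans (cong (λ i → lookup T (P ⟨$⟩ʳ i)) (toℕ-injective i≡j)) eq
  ... | inj₁ i<j with ≺-uncons T (sa i j i<j)
  ...   | inj₁ (eqᵃ , _) = eqᵃ
  ...   | inj₂ (eq′ , _) = trans eq′ eq

  -- By monotonicity one change from a to b determines the letters at all ranks, with s = `pos i`.
  break-form : ∀ {i j} → Break T P i j → HasForm T P (pos i)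
  break-form {i} {j} (nx , eqᵃ , eqᵇ) = record
    { 1≤s     = s≤s z≤n
    ; s≤n-1   = subst (_≤ m) nx (≤-pred (toℕ<n j))
    ; inside  = λ { x (r , le , refl) → letters-sorted (≤-pred le) eqᵃ }
    ; outside = outside
    }
    where
    outside : ∀ x → ¬ AmongFirst P (pos i) x → lookup T x ≡ b
    outside x ¬first with a⊎b (lookup T x)
    ... | inj₂ eq = eq
    ... | inj₁ eq with pos (P ⟨$⟩ˡ x) ≤? pos i
    ...   | yes le = contradiction (P ⟨$⟩ˡ x , le , inverseʳ P) ¬first
    ...   | no ¬le = contradiction eqᵇ (a≢b (letters-sorted
      (subst (_≤ toℕ (P ⟨$⟩ˡ x)) (sym nx) (≤-pred (≰⇒> ¬le)))
      (trans (cong (lookup T) (inverseʳ P)) eq)))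

  break-unique : ∀ {i j i′ j′} → Break T P i j → Break T P i′ j′ → i ≡ i′
  break-unique br br′ = toℕ-injective (≤-antisym (≮⇒≥ (¬before br′ br)) (≮⇒≥ (¬before br br′)))
    where
    ¬before : ∀ {i j i′ j′} → Break T P i j → Break T P i′ j′ → ¬ i Fin.< i′
    ¬before (nx , _ , eqᵇ) (_ , eqᵃ , _) lt =
      a≢b (letters-sorted (subst (_≤ _) (sym nx) lt) eqᵃ) eqᵇ

  -- The suffix T[n..n] is a single letter, so a smaller nonempty suffix starts with a
  -- smaller letter.
  break-at-end : ∀ {j} → toℕ (P ⟨$⟩ʳ j) ≡ m → ∀ {i} → Next i j → Break T P i j
  break-at-end {j} end {i} nx with ≺-uncons T (sa i j (≤-reflexive (sym nx)))
  ... | inj₁ (eqᵃ , eqᵇ) = nx , eqᵃ , eqᵇ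
  ... | inj₂ (_ , lt) rewrite end | drop-all T = contradiction lt xs≮[]

  -- The suffix at p_n is the largest one, so prepending the same letter to it and
  -- to another suffix cannot reverse their order.
  break-before-last : ∀ {i} → suc (toℕ (P ⟨$⟩ʳ i)) ≡ toℕ (P ⟨$⟩ʳ fromℕ m) →
                      ∀ {j} → Next i j → Break T P i j
  break-before-last {i} before {j} nx with ≺-uncons T (sa i j (≤-reflexive (sym nx)))
  ... | inj₁ (eqᵃ , eqᵇ) = nx , eqᵃ , eqᵇ
  ... | inj₂ (_ , lt) rewrite before with pos (P ⟨$⟩ʳ j) <? suc m
  ...   | no ¬lt rewrite ≤-antisym (toℕ<n (P ⟨$⟩ʳ j)) (≮⇒≥ ¬lt) | drop-all T =
    contradiction lt xs≮[]
  ...   | yes y<n = contradiction lt′ (last-largest (m≤n⇒m<n∨m≡n (≤fromℕ r)))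
    where
    r = proj₁ (rank P y<n)
    last = fromℕ m
    lt′ : suffix T (P ⟨$⟩ʳ last) ≺ suffix T (P ⟨$⟩ʳ r)
    lt′ = subst (λ x → suffix T (P ⟨$⟩ʳ last) ≺ drop x (toList T)) (sym (proj₂ (rank P y<n))) lt
    last-largest : r Fin.< last ⊎ toℕ r ≡ toℕ last →
                   ¬ suffix T (P ⟨$⟩ʳ last) ≺ suffix T (P ⟨$⟩ʳ r)
    last-largest (inj₁ r<last) = ≺-asym (sa r last r<last)
    last-largest (inj₂ r≡last) rewrite toℕ-injective r≡last = λ gt → ≺-asym gt gt

  -- A break is forced before position n unless p₁ = n, and at p_n - 1 unless p_n = 1. Both
  -- exceptions together would give k = n - 1, so a break exists; if both conditions force one, it
  -- is the same one by uniqueness.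
  break-admissible : ∀ {k} → ArithProgressed k P → k < m →
    ∃ λ i → ∃ λ j → Break T P i j ×
    Admissible m k (toℕ (P ⟨$⟩ʳ zero)) (toℕ (P ⟨$⟩ʳ fromℕ m)) (toℕ (P ⟨$⟩ʳ i))
  break-admissible {k} ap k<m = classify (q zero ≟ m) (q (fromℕ m) ≟ 0)
    where
    n = suc m
    q : Fin n → ℕ
    q i = toℕ (P ⟨$⟩ʳ i)
    EndBreak LastBreak : Fin n → Fin n → Set
    EndBreak i j = Break T P i j × q i + k ≡ m
    LastBreak i j = Break T P i j × suc (q i) ≡ q (fromℕ m)
    -- Since k < n, an addition of k that wraps never lands on position n.
    ¬wraps : ∀ {x} → x ≤ m → x + k ≢ m + n
    ¬wraps x≤m eq = <-irrefl eq (+-mono-≤-< x≤m (m<n⇒m<1+n k<m))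
    endBreak : q zero ≢ m → ∃ λ i → ∃ λ j → EndBreak i j
    endBreak q₀≢m with rank P {m} ≤-refl
    ... | j , eq with prev? j
    ...   | inj₁ refl     = contradiction eq q₀≢m
    ...   | inj₂ (i , nx) with subst (Shift n k (q i)) eq (ap-shift ap nx)
    ...     | direct e  = i , j , break-at-end eq nx , e
    ...     | wrapped e = contradiction e (¬wraps (≤-pred (toℕ<n (P ⟨$⟩ʳ i))))
    lastBreak : q (fromℕ m) ≢ 0 → ∃ λ i → ∃ λ j → LastBreak i j
    lastBreak ql≢0 with q (fromℕ m) in eq
    ... | zero  = contradiction refl ql≢0
    ... | suc x with rank P {x} (<-trans ≤-refl (subst (_< n) eq (toℕ<n (P ⟨$⟩ʳ fromℕ m))))
    ...   | i , q-i with next? i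
    ...     | inj₁ refl     = contradiction (trans (sym eq) q-i) 1+n≢n
    ...     | inj₂ (j , nx) =
      i , j , break-before-last (trans (cong suc q-i) (sym eq)) nx , cong suc q-i
    result : ∀ {i j} → Break T P i j →
             q (fromℕ m) ≡ 0 ⊎ q (fromℕ m) ≡ suc (q i) → q zero ≡ m ⊎ q i + k ≡ m → _
    result {i} {j} br atLast atEnd = i , j , br , record
      { p<n = toℕ<n _ ; l<n = toℕ<n _ ; e<n = toℕ<n _ ; wrap = ap-wrap ap
      ; e≢l = λ eq → ¬next-last (subst (λ i → Next i j) (⟨$⟩ʳ-injective P (toℕ-injective eq)) (proj₁ br))
      ; atLast = atLast ; atEnd = atEnd }
    classify : Dec (q zero ≡ m) → Dec (q (fromℕ m) ≡ 0) → _
    classify (yes q₀≡m) (yes ql≡0) with subst₂ (Shift n k) ql≡0 q₀≡m (ap-wrap ap)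
    ... | direct k≡m = contradiction k<m (<-irrefl k≡m)
    ... | wrapped eq = contradiction eq (¬wraps z≤n)
    classify (no q₀≢m) (yes ql≡0) with endBreak q₀≢m
    ... | i , j , br , eq = result br (inj₁ ql≡0) (inj₂ eq)
    classify (yes q₀≡m) (no ql≢0) with lastBreak ql≢0
    ... | i , j , br , eq = result br (inj₂ (sym eq)) (inj₁ q₀≡m)
    classify (no q₀≢m) (no ql≢0) with endBreak q₀≢m | lastBreak ql≢0
    ... | i , j , br , eq | i′ , j′ , br′ , eq′ with break-unique br br′
    ...   | refl = result br (inj₂ (sym eq′)) (inj₂ eq)

  -- The letter a occurs only at ranks up to that of the break, and suffixes increase with rank.
  break-starts-largest : ∀ {i j} → Break T P i j → StartsLargestASuffix T (P ⟨$⟩ʳ i)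
  break-starts-largest {i} br@(nx , eqᵃ , eqᵇ) = eqᵃ , largest
    where
    largest : ∀ x → lookup T x ≡ a → x ≢ P ⟨$⟩ʳ i → suffix T x ≺ suffix T (P ⟨$⟩ʳ i)
    largest x eq x≢ with pos (P ⟨$⟩ˡ x) ≤? pos i
    ... | no ¬le = contradiction (letter-b (break-form br) (≰⇒> ¬le))
                     (a≢b (trans (cong (lookup T) (inverseʳ P)) eq))
    ... | yes le = subst (λ x → suffix T x ≺ suffix T (P ⟨$⟩ʳ i)) (inverseʳ P) (sa _ i
      (≤∧≢⇒< (≤-pred le) λ same → x≢ (trans (sym (inverseʳ P)) (cong (P ⟨$⟩ʳ_) (toℕ-injective same)))))

-- Distinctness, periodicity and the Lyndon property.

module _ {m k p y : ℕ} {T : Word (suc m)} (det : DeterminedBy k (suc p) y T) where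
  open DeterminedBy det

  determined⇒AP : HasAPSuffixArray k T
  determined⇒AP with attained
  ... | P , _ , sa , ap , _ = P , sa , ap

  determined-first : ∀ {p′ y′} → DeterminedBy k (suc p′) y′ T → p ≡ p′
  determined-first det′ with attained | DeterminedBy.attained det′
  ... | P , _ , saP , _ , _ , p-1 , _ | Q , _ , saQ , _ , _ , q-1 , _ =
    trans (sym (entry P p-1)) (trans (cong toℕ (first-unique T P Q saP saQ)) (entry Q q-1))

-- Beyond both l and e neither exception of `letter-shift` arises. A wrapped addition of k is a step
-- back by n - k, so this yields the periods.
determined-shift : ∀ {m k p l e} {T : Word (suc m)} → Admissible m k p l e →
                   DeterminedBy k (suc p) (suc e) T →
                   ∀ {x y} → Shift (suc m) k (toℕ x) (toℕ y) → l < toℕ x → e < toℕ x →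
                   lookup T x ≡ lookup T y
determined-shift {m} {k} {l = l} adm det sh l<x e<x with DeterminedBy.attained det
... | P , _ , _ , ap , form , p-1 , p-s =
  letter-shift ap form p-s sh
    (λ x≡last → <-irrefl (sym (trans x≡last last≡l)) l<x) (λ x≡e → <-irrefl (sym x≡e) e<x)
  where
  open Admissible adm
  last≡l = ap-last ap l<n (subst (Shift (suc m) k l) (sym (entry P p-1)) wrap)

-- The whole string is smaller than the shorter suffix T[r+1..n] and not a prefix of it, so
-- the comparison is not affected by completing the latter to a rotation.
smallest⇒Lyndon : ∀ {m} (T : Word (suc m)) P → IsSuffixArray T P → P ⟨$⟩ʳ zero ≡ zero → IsLyndon T
smallest⇒Lyndon T P sa P₀ r 1≤r r<n = ≺-++ʳ (take r (toList T)) shorter smaller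
  where
  shorter : length (drop r (toList T)) ≤ length (toList T)
  shorter = subst (_≤ length (toList T)) (sym (length-drop r (toList T))) (m∸n≤m _ r)
  smaller : toList T ≺ drop r (toList T)
  smaller with rank P r<n
  ... | zero  , eq = contradiction (subst (1 ≤_) (trans (sym eq) (cong toℕ P₀)) 1≤r) λ ()
  ... | suc i , eq =
    subst₂ (λ x y → drop x (toList T) ≺ drop y (toList T)) (cong toℕ P₀) eq (sa zero (suc i) z<s)

-- The three cases.

-- h stands for n - k - 2.
module _ {h k : ℕ} where

  private
    m n : ℕ
    m = suc (h + k)
    n = suc m
    k<n : k < n
    k<n = s≤s (m≤n⇒m≤1+n (m≤n+m k h))

  -- From p₁ = n follows p_n = n - k, and the change just before p_n gives p_s = n - k - 1.
  admissible₁ : Admissible m k m (suc h) h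
  admissible₁ = record
    { p<n = ≤-refl ; l<n = s≤s (s≤s (m≤m+n h k)) ; e<n = s≤s (m≤n⇒m≤1+n (m≤m+n h k))
    ; wrap = direct refl ; e≢l = λ eq → 1+n≢n (sym eq) ; atLast = inj₂ refl ; atEnd = inj₁ refl }

  -- With p_n = 1 only the condition at position n remains, giving p_s = n - k.
  admissible₂ : Admissible m k k 0 (suc h)
  admissible₂ = record
    { p<n = k<n ; l<n = z<s ; e<n = s≤s (s≤s (m≤m+n h k))
    ; wrap = direct refl ; e≢l = λ () ; atLast = inj₁ refl ; atEnd = inj₂ refl }

  -- Here p_n = n - k + 1, so both conditions apply and agree on p_s = n - k.
  admissible₃ : 1 ≤ k → Admissible m k 0 (suc (suc h)) (suc h)
  admissible₃ 1≤k = record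
    { p<n = z<s ; l<n = s≤s (s≤s (m<m+n h 1≤k)) ; e<n = s≤s (s≤s (m≤m+n h k))
    ; wrap = wrapped refl ; e≢l = λ eq → 1+n≢n (sym eq) ; atLast = inj₂ refl ; atEnd = inj₂ refl }

  -- The alternatives of `atLast` and `atEnd` combine in four ways. With l = 0 the shift forces p =
  -- k, which excludes p = m; each of the other three combinations fixes p and e.
  admissible-cases : ∀ {p l e} → Admissible m k p l e →
    (p ≡ m × e ≡ h) ⊎ (p ≡ k × e ≡ suc h) ⊎ (p ≡ 0 × e ≡ suc h)
  admissible-cases {p} {l} {e} adm = go atLast atEnd
    where
    open Admissible adm
    go : l ≡ 0 ⊎ l ≡ suc e → p ≡ m ⊎ e + k ≡ m → _
    go (inj₁ refl) end with Shift-functional p<n k<n wrap (direct refl) | end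
    ... | refl | inj₁ k≡m = contradiction (m≤n+m k h) (<⇒≱ (≤-reflexive (sym k≡m)))
    ... | refl | inj₂ e+k≡m = inj₂ (inj₁ (refl , +-cancelʳ-≡ k e (suc h) e+k≡m))
    go (inj₂ refl) (inj₁ refl) =
      inj₁ (refl , suc-injective (Shift-injective l<n (Admissible.l<n admissible₁) wrap (direct refl)))
    go (inj₂ refl) (inj₂ e+k≡m) =
      inj₂ (inj₂ (Shift-functional p<n z<s wrap (wrapped (cong suc e+k≡m)) ,
                  +-cancelʳ-≡ k e (suc h) e+k≡m))

  three-words : 1 ≤ k →
    Σ (Word n) (DeterminedBy k n (suc h)) →
    Σ (Word n) (DeterminedBy k (suc k) (suc (suc h))) →
    Σ (Word n) (DeterminedBy k 1 (suc (suc h))) →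
    Σ (Word n) λ T₁ → Σ (Word n) λ T₂ → Σ (Word n) λ T₃ →
    (T₁ ≢ T₂ × T₁ ≢ T₃ × T₂ ≢ T₃) ×
    ((T : Word n) → HasAPSuffixArray k T ⇔ (T ≡ T₁ ⊎ T ≡ T₂ ⊎ T ≡ T₃)) ×
    ((T : Word n) (P : Permutation′ n) → IsSuffixArray T P → ArithProgressed k P →
    Σ ℕ λ s → HasForm T P s ×
    ((i : Fin n) → pos i ≡ s → StartsLargestASuffix T (P ⟨$⟩ʳ i))) ×
    DeterminedBy k n (suc h) T₁ ×
    DeterminedBy k (suc k) (suc (suc h)) T₂ ×
    DeterminedBy k 1 (suc (suc h)) T₃ ×
    HasPeriod (suc (suc h)) T₁ ×
    HasPeriod (suc (suc h)) T₂ ×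
    IsLyndon T₃
  three-words 1≤k (T₁ , det₁) (T₂ , det₂) (T₃ , det₃) =
    T₁ , T₂ , T₃ ,
    -- The values n, k + 1 and 1 of p₁ are pairwise different.
    ( (λ { refl → <-irrefl (sym (determined-first det₁ det₂)) (s≤s (m≤n+m k h)) })
    , (λ { refl → contradiction (determined-first det₁ det₃) λ () })
    , (λ { refl → <-irrefl (sym (determined-first det₂ det₃)) 1≤k })) ,
    (λ T → mk⇔ classify λ { (inj₁ refl) → determined⇒AP det₁
                          ; (inj₂ (inj₁ refl)) → determined⇒AP det₂
                          ; (inj₂ (inj₂ refl)) → determined⇒AP det₃ }) ,
    shape , det₁ , det₂ , det₃ ,
    record { 1≤p = s≤s z≤n ; p≤n-1 = period≤m ; repeat = λ i j eq →
      sym (determined-shift admissible₁ det₁ (back i j eq) (far eq) (<-trans ≤-refl (far eq))) } ,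
    record { 1≤p = s≤s z≤n ; p≤n-1 = period≤m ; repeat = λ i j eq →
      sym (determined-shift admissible₂ det₂ (back i j eq) (<-≤-trans z<s (far eq)) (far eq)) } ,
    lyndon
    where
    k<m : k < m
    k<m = s≤s (m≤n+m k h)
    period≤m : suc (suc h) ≤ m
    period≤m = s≤s (m<m+n h 1≤k)
    -- The later position exceeds n - k, hence lies beyond both p_s and p_n in cases (1) and (2).
    far : {i j : Fin n} → pos j ≡ pos i + suc (suc h) → suc h < toℕ j
    far {i} {j} eq = subst (suc h <_) (sym (suc-injective eq)) (m≤n+m (suc (suc h)) (toℕ i))
    back : (i j : Fin n) → pos j ≡ pos i + suc (suc h) → Shift n k (toℕ j) (toℕ i)
    back i j eq = wrapped (trans (cong (_+ k) (suc-injective eq)) (+-assoc (toℕ i) (suc (suc h)) k))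
    classify : ∀ {T} → HasAPSuffixArray k T → T ≡ T₁ ⊎ T ≡ T₂ ⊎ T ≡ T₃
    classify {T} (P , sa , ap) with break-admissible T P sa ap k<m
    ... | i , j , br , adm with admissible-cases adm
    ...   | inj₁ (p , e)        = inj₁ (DeterminedBy.unique det₁ T P _ ap (break-form T P sa br)
                                    (zero , refl , cong suc p) (i , refl , cong suc e))
    ...   | inj₂ (inj₁ (p , e)) = inj₂ (inj₁ (DeterminedBy.unique det₂ T P _ ap (break-form T P sa br)
                                    (zero , refl , cong suc p) (i , refl , cong suc e)))
    ...   | inj₂ (inj₂ (p , e)) = inj₂ (inj₂ (DeterminedBy.unique det₃ T P _ ap (break-form T P sa br)
                                    (zero , refl , cong suc p) (i , refl , cong suc e)))
    shape : ∀ T P → IsSuffixArray T P → ArithProgressed k P → Σ ℕ λ s → HasForm T P s ×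
            (∀ i → pos i ≡ s → StartsLargestASuffix T (P ⟨$⟩ʳ i))
    shape T P sa ap with break-admissible T P sa ap k<m
    ... | i , j , br , _ = pos i , break-form T P sa br , λ i′ eq →
      subst (λ i → StartsLargestASuffix T (P ⟨$⟩ʳ i)) (sym (toℕ-injective (suc-injective eq)))
        (break-starts-largest T P sa br)
    lyndon : IsLyndon T₃
    lyndon with DeterminedBy.attained det₃
    ... | P , _ , sa , _ , _ , p-1 , _ = smallest⇒Lyndon T₃ P sa (toℕ-injective (entry P p-1))

theorem10 : (n k : ℕ) → 3 ≤ n → 1 ≤ k → k ≤ n ∸ 2 → Coprime k n →
    Σ (Word n) λ T₁ → Σ (Word n) λ T₂ → Σ (Word n) λ T₃ →
    (T₁ ≢ T₂ × T₁ ≢ T₃ × T₂ ≢ T₃) ×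
    ((T : Word n) → HasAPSuffixArray k T ⇔ (T ≡ T₁ ⊎ T ≡ T₂ ⊎ T ≡ T₃)) ×
    ((T : Word n) (P : Permutation′ n) → IsSuffixArray T P → ArithProgressed k P →
    Σ ℕ λ s → HasForm T P s ×
    ((i : Fin n) → pos i ≡ s → StartsLargestASuffix T (P ⟨$⟩ʳ i))) ×
    DeterminedBy k n (n ∸ k ∸ 1) T₁ ×
    DeterminedBy k (suc k) (n ∸ k) T₂ ×
    DeterminedBy k 1 (n ∸ k) T₃ ×
    HasPeriod (n ∸ k) T₁ ×
    HasPeriod (n ∸ k) T₂ ×
    IsLyndon T₃
theorem10 (suc zero) k (s≤s ()) _ _ _
-- Replacing m by h + k turns `n ∸ k` into `suc (suc h)`.
theorem10 (suc (suc m)) k _ 1≤k k≤m cop with m ∸ k | m∸n+n≡m k≤m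
... | h | refl rewrite m+n∸n≡m (suc (suc h)) k =
  three-words 1≤k (determined 1≤k k≤n-1 cop admissible₁) (determined 1≤k k≤n-1 cop admissible₂)
    (determined 1≤k k≤n-1 cop (admissible₃ 1≤k))
  where
  k≤n-1 : k ≤ suc (h + k)
  k≤n-1 = m≤n⇒m≤1+n k≤m
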